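{- $\operatorname{olws}_R(3)=5$, where $\operatorname{olws}_R(w)$ denotes the on-line width of the class of semi-orders of width at most $w$ presented with (unit-interval) representation.
   Context: Semi-orders with representation. A finite sequence of closed unit-length intervals $[r_1-1,r_1],\ldots,[r_n-1,r_n]$ on the real line (repetitions of the same interval are allowed, and different indices are different elements) represents the poset on elements $x_1,\ldots,x_n$ in which $x_i<x_j$ if and only if $r_i<r_j-1$; thus two distinct elements are incomparable exactly when their intervals intersect. Posets arising in this way are called semi-orders. The width of a poset is the maximum size of an antichain. On-line chain partitioning game. Fix a positive integer $w$. In round $i$ the presenter introduces an element $x_i$ by giving a closed unit interval $[r_i-1,r_i]$ (i.e. the real number $r_i$), such that the semi-order represented by all intervals presented so far has width at most $w$. The (deterministic) on-line algorithm must then immediately and irrevocably assign $x_i$ to a chain, i.e. give it a chain label such that all elements with the same label are pairwise comparable (their intervals are pairwise disjoint). The assignment may depend only on the intervals presented so far and on the chains to which the earlier elements were assigned. The presenter may choose each interval depending on the algorithm's previous assignments. The number of chains used is the number of distinct labels used. On-line width. $\operatorname{olws}_R(w)$ is the largest integer $k$ for which there exists a strategy of the presenter that forces any on-line algorithm to use (at least) $k$ chains on a semi-order of width at most $w$ presented in this way as unit intervals. -}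

module Defs where

open import Data.Fin using (Fin)
open import Data.Fin.Subset using (Subset; ∣_∣) renaming (_∈_ to _∈ₛ_)
open import Data.List using (List; []; _∷_; map; length; lookup; deduplicate)
open import Data.List.Relation.Binary.Pointwise using (Pointwise)
import Data.Nat as ℕ
open ℕ using (ℕ; zero; suc)
import Data.Product.Relation.Binary.Pointwise.NonDependent as Product
open import Data.Product using (Σ; ∃; _×_; _,_; proj₁; proj₂)
open import Data.Rational using (ℚ; _<_; _+_; _-_; 1ℚ)
open import Data.Rational.Properties using (+-assoc; +-identityʳ; +-inverseˡ; +-inverseʳ; +-monoˡ-<)
open import Data.Sum using (_⊎_; inj₁; inj₂)
open import Level using (0ℓ)
open import Relation.Binary.PropositionalEquality
  using (_≡_; _≢_; sym; trans; cong; subst)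
open import Relation.Nullary using (¬_)
open import Relation.Unary using (Pred; _≐_)

------------------------------------------------------------------------
-- The real numbers, as two-sided Dedekind cuts of ℚ

record ℝ : Set₁ where
  field
    L U          : Pred ℚ 0ℓ
    L-inhabited  : ∃ L
    U-inhabited  : ∃ U
    L-closed     : ∀ {p q} → p < q → L q → L p
    U-closed     : ∀ {p q} → p < q → U p → U q
    L-open       : ∀ {p} → L p → ∃ λ q → p < q × L q
    U-open       : ∀ {q} → U q → ∃ λ p → p < q × U p
    disjoint     : ∀ {q} → ¬ (L q × U q)
    located      : ∀ {p q} → p < q → L p ⊎ U q

open ℝ

infix 4 _<ᵣ_ _≈ᵣ_

_<ᵣ_ : ℝ → ℝ → Set
r <ᵣ s = ∃ λ q → U r q × L s q

_≈ᵣ_ : ℝ → ℝ → Set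
r ≈ᵣ s = (L r ≐ L s) × (U r ≐ U s)

private
  q-1+1 : ∀ q → (q - 1ℚ) + 1ℚ ≡ q
  q-1+1 q = trans (+-assoc q _ 1ℚ) (trans (cong (q +_) (+-inverseˡ 1ℚ)) (+-identityʳ q))

  q+1-1 : ∀ q → (q + 1ℚ) - 1ℚ ≡ q
  q+1-1 q = trans (+-assoc q 1ℚ _) (trans (cong (q +_) (+-inverseʳ 1ℚ)) (+-identityʳ q))

-- A rational lies below (above) r - 1 iff its successor lies below (above) r.
infix 8 _-1ᵣ
_-1ᵣ : ℝ → ℝ
L (r -1ᵣ) q = L r (q + 1ℚ)
U (r -1ᵣ) q = U r (q + 1ℚ)
L-inhabited (r -1ᵣ) = let q , h = L-inhabited r in q - 1ℚ , subst (L r) (sym (q-1+1 q)) h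
U-inhabited (r -1ᵣ) = let q , h = U-inhabited r in q - 1ℚ , subst (U r) (sym (q-1+1 q)) h
L-closed (r -1ᵣ) p<q = L-closed r (+-monoˡ-< 1ℚ p<q)
U-closed (r -1ᵣ) p<q = U-closed r (+-monoˡ-< 1ℚ p<q)
L-open (r -1ᵣ) {p} h =
  let q , p+1<q , h′ = L-open r h in
  q - 1ℚ , subst (_< q - 1ℚ) (q+1-1 p) (+-monoˡ-< _ p+1<q) , subst (L r) (sym (q-1+1 q)) h′
U-open (r -1ᵣ) {q} h =
  let p , p<q+1 , h′ = U-open r h in
  p - 1ℚ , subst (p - 1ℚ <_) (q+1-1 q) (+-monoˡ-< _ p<q+1) , subst (U r) (sym (q-1+1 p)) h′
disjoint (r -1ᵣ) = disjoint r
located (r -1ᵣ) p<q = located r (+-monoˡ-< 1ℚ p<q)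

------------------------------------------------------------------------
-- Represented semi-orders

-- An entry r stands for the closed interval [r - 1 , r].  The elements of the
-- poset are the positions of the list, so repeated intervals are distinct
-- elements.
Representation : Set₁
Representation = List ℝ

infix 4 _≺_
_≺_ : ℝ → ℝ → Set
r ≺ s = r <ᵣ s -1ᵣ

Comparable : ℝ → ℝ → Set
Comparable r s = r ≺ s ⊎ s ≺ r

IsAntichain : (rs : Representation) → Subset (length rs) → Set
IsAntichain rs S = ∀ {i j} → i ∈ₛ S → j ∈ₛ S → i ≢ j →
  ¬ Comparable (lookup rs i) (lookup rs j)

WidthAtMost : ℕ → Representation → Set
WidthAtMost w rs = ∀ (S : Subset (length rs)) → IsAntichain rs S → ∣ S ∣ ℕ.≤ w

------------------------------------------------------------------------
-- The on-line chain partitioning game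

Label : Set
Label = ℕ

-- The intervals presented so far (as in a representation) with the chains they
-- were assigned to.  In representations and histories alike, the most recently
-- presented element comes first.
History : Set₁
History = List (ℝ × Label)

_≈ₕ_ : History → History → Set₁
_≈ₕ_ = Pointwise (Product.Pointwise _≈ᵣ_ _≡_)

intervals : History → Representation
intervals = map proj₁

labels : History → List Label
labels = map proj₂

chainsUsed : History → ℕ
chainsUsed h = length (deduplicate ℕ._≟_ (labels h))

IsChainPartition : History → Set
IsChainPartition h = ∀ (i j : Fin (length h)) → i ≢ j →
  proj₂ (lookup h i) ≡ proj₂ (lookup h j) →
  Comparable (proj₁ (lookup h i)) (proj₁ (lookup h j))

run : (History → ℝ → Label) → Representation → History
run assign []       = []
run assign (r ∷ rs) = let h = run assign rs in (r , assign h r) ∷ h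

-- Reals are cuts up to _≈ᵣ_, so a function of reals has to respect _≈ᵣ_.
record OnLineAlgorithm (w : ℕ) : Set₁ where
  field
    assign      : History → ℝ → Label
    assign-cong : ∀ {h h′ r r′} → h ≈ₕ h′ → r ≈ᵣ r′ → assign h r ≡ assign h′ r′
    correct     : ∀ rs → WidthAtMost w rs → IsChainPartition (run assign rs)

open OnLineAlgorithm

-- The next interval depends on the labels given by the algorithm so far; the
-- earlier intervals are determined by the strategy and those labels.
PresenterStrategy : Set₁
PresenterStrategy = List Label → ℝ

play : ∀ {w} → PresenterStrategy → OnLineAlgorithm w → ℕ → History
play S A zero    = []
play S A (suc n) = let h = play S A n ; r = S (labels h) in (r , assign A h r) ∷ h

-- The presenter stops after n rounds, where n may depend on the course of the
-- game.  Bounding the width then bounds it at every earlier round as well.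
Forces : (w k : ℕ) → PresenterStrategy → Set₁
Forces w k S = (A : OnLineAlgorithm w) → ∃ λ n →
  WidthAtMost w (intervals (play S A n)) × k ℕ.≤ chainsUsed (play S A n)

-- olwsR w ≔ k: the largest number that some presenter strategy forces is k.
olwsR_≔_ : ℕ → ℕ → Set₁
olwsR w ≔ k = Σ PresenterStrategy (Forces w k)
            × (∀ k′ → Σ PresenterStrategy (Forces w k′) → k′ ℕ.≤ k)

{-# OPTIONS --safe #-}

-- Upper bound: an interval that meets [r - 1 , r] contains r - 1 or r.  The
-- intervals containing r form an antichain, as do those containing r - 1, and
-- [r - 1 , r] belongs to both.  So in width 3 at most 2 + 2 earlier intervals meet
-- [r - 1 , r], and one of five labels is always available.
--
-- Lower bound: the presenter already wins with all endpoints in ⅙ℤ, by a finite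
-- game tree that was found by exhaustive search and is verified by computation.

module Submission where

open import Defs
open import Axiom.ExcludedMiddle using (ExcludedMiddle)
open import Data.Fin using (Fin; zero; suc; cast)
import Data.Fin.Properties as Fin using (_≟_)
open import Data.Fin.Subset using (Subset; ∣_∣; inside; outside; Nonempty) renaming (_∈_ to _∈ₛ_)
open import Data.Fin.Subset.Properties using (nonempty?; Empty-unique; ∣⊥∣≡0)
open import Data.Integer using (+_)
open import Data.List
  using (List; []; _∷_; [_]; map; length; lookup; filter; upTo; replicate; _++_)
open import Data.List.Membership.Propositional using (_∈_; _∉_; find)
open import Data.List.Membership.Propositional.Properties
  using
  ( ∈-∃++; ∈-++⁻; ∈-++⁺ˡ; ∈-++⁺ʳ; ∈-lookup; ∈-upTo⁺; ∈-upTo⁻; ∈-map⁺; ∈-filter⁺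
  ; ∈-deduplicate⁺; ∈-deduplicate⁻)
open import Data.List.Properties
  using (length-++; length-map; length-upTo; filter-accept)
import Data.List.Relation.Binary.Pointwise as Pointwise
open Pointwise using (Pointwise; []; _∷_)
open import Data.List.Relation.Unary.All as All using (All; []; _∷_; all?)
open import Data.List.Relation.Unary.All.Properties using (¬All⇒Any¬)
open import Data.List.Relation.Unary.AllPairs using ([]; _∷_)
open import Data.List.Relation.Unary.Any as Any using (Any; here; there; any?)
open import Data.List.Relation.Unary.Any.Properties using (lookup-index)
open import Data.List.Relation.Unary.Unique.Propositional using (Unique)
open import Data.List.Relation.Unary.Unique.Propositional.Properties using (upTo⁺)
open import Data.Nat using (ℕ; zero; suc; _+_; _≤_; _<_; _⊔_; _≟_; _≤?_; _<?_; z≤n; s≤s; s≤s⁻¹)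
import Data.Nat.Properties as ℕ
open import Data.List.Membership.DecPropositional _≟_ using (_∈?_)
open import Data.List.Relation.Unary.Unique.DecPropositional.Properties _≟_ using (deduplicate-!)
open import Data.Product using (∃; _×_; _,_; proj₁; proj₂)
import Data.Rational as ℚ
open ℚ using (ℚ; 0ℚ; 1ℚ)
import Data.Rational.Properties as ℚ
open import Data.Rational.Solver using (module +-*-Solver)
open import Data.Sum as Sum using (_⊎_; inj₁; inj₂; [_,_]′; swap)
open import Data.Vec as Vec using (here; there)
open import Function using (_∘_; _$_; id)
open import Level using (0ℓ)
open import Relation.Binary.Definitions using (tri<; tri≈; tri>)
open import Relation.Binary.PropositionalEquality
  using (_≡_; _≢_; refl; sym; trans; cong; cong₂; subst)
open import Relation.Nullary using (¬_; Dec; yes; no; contradiction; does)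
open import Relation.Nullary.Decidable using (from-yes; _×-dec_; _⊎-dec_)

-- Lists and subsets

-- Pigeonhole by induction on `xs`: the occurrence of `x` is cut out of `ys`, and uniqueness keeps
-- the other elements of `xs` inside what is left.
unique-⊆⇒length-≤ : ∀ {A : Set} {xs ys : List A} → Unique xs →
  (∀ {x} → x ∈ xs → x ∈ ys) → length xs ≤ length ys
unique-⊆⇒length-≤ [] _ = z≤n
unique-⊆⇒length-≤ {xs = x ∷ xs} (x∉xs ∷ uxs) sub with ∈-∃++ (sub (here refl))
... | us , vs , refl = begin
  suc (length xs)            ≤⟨ s≤s (unique-⊆⇒length-≤ uxs rest) ⟩
  suc (length (us ++ vs))    ≡⟨ cong suc (length-++ us) ⟩
  suc (length us + length vs) ≡⟨ ℕ.+-suc (length us) (length vs) ⟨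
  length us + suc (length vs) ≡⟨ length-++ us ⟨
  length (us ++ x ∷ vs)      ∎
  where
  open ℕ.≤-Reasoning
  rest : ∀ {y} → y ∈ xs → y ∈ us ++ vs
  rest y∈xs with ∈-++⁻ us (sub (there y∈xs))
  ... | inj₁ y∈us         = ∈-++⁺ˡ y∈us
  ... | inj₂ (here refl)  = contradiction refl (All.lookup x∉xs y∈xs)
  ... | inj₂ (there y∈vs) = ∈-++⁺ʳ us y∈vs

-- The numbers from 0 to `length ls` are one too many to all occur in `ls`.
avoid : (ls : List ℕ) → ∃ λ l → l ∉ ls × l ≤ length ls
avoid ls with all? (_∈? ls) (upTo (suc (length ls)))
... | yes all∈ = contradiction
  (subst (_≤ length ls) (length-upTo (suc (length ls)))
    (unique-⊆⇒length-≤ (upTo⁺ _) (All.lookup all∈)))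
  (ℕ.<-irrefl refl)
... | no ¬all∈ with find (¬All⇒Any¬ (_∈? ls) _ ¬all∈)
... | l , l∈ , l∉ls = l , l∉ls , s≤s⁻¹ (∈-upTo⁻ l∈)

select : ∀ {A : Set₁} {P : A → Set} → (∀ x → Dec (P x)) → (xs : List A) → Subset (length xs)
select P? []       = Vec.[]
select P? (x ∷ xs) = does (P? x) Vec.∷ select P? xs

∣select∣ : ∀ {A : Set₁} {P : A → Set} (P? : ∀ x → Dec (P x)) xs →
  ∣ select P? xs ∣ ≡ length (filter P? xs)
∣select∣ P? [] = refl
∣select∣ P? (x ∷ xs) with P? x
... | yes _ = cong suc (∣select∣ P? xs)
... | no  _ = ∣select∣ P? xs

∈-select⁻ : ∀ {A : Set₁} {P : A → Set} (P? : ∀ x → Dec (P x)) xs {i} →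
  i ∈ₛ select P? xs → P (lookup xs i)
∈-select⁻ P? (x ∷ xs) {i} i∈ with P? x
∈-select⁻ P? (x ∷ xs) {zero}  i∈         | yes px = px
∈-select⁻ P? (x ∷ xs) {suc i} (there i∈) | yes _  = ∈-select⁻ P? xs i∈
∈-select⁻ P? (x ∷ xs) {suc i} (there i∈) | no _   = ∈-select⁻ P? xs i∈

lookup-map : ∀ {A : Set} {B : Set₁} (f : A → B) xs i →
  lookup (map f xs) i ≡ f (lookup xs (cast (length-map f xs) i))
lookup-map f (x ∷ xs) zero    = refl
lookup-map f (x ∷ xs) (suc i) = lookup-map f xs i

∣∣≤length-filter : ∀ {A : Set} {B : Set₁} {P : A → Set} (P? : ∀ x → Dec (P x)) (f : A → B) xs
  (S : Subset (length (map f xs))) →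
  (∀ {i} → i ∈ₛ S → P (lookup xs (cast (length-map f xs) i))) → ∣ S ∣ ≤ length (filter P? xs)
∣∣≤length-filter P? f [] Vec.[] all∈ = z≤n
∣∣≤length-filter P? f (x ∷ xs) (inside Vec.∷ S) all∈ with P? x
... | yes _  = s≤s (∣∣≤length-filter P? f xs S (all∈ ∘ there))
... | no ¬px = contradiction (all∈ here) ¬px
∣∣≤length-filter P? f (x ∷ xs) (outside Vec.∷ S) all∈ with P? x
... | yes _  = ℕ.m≤n⇒m≤1+n (∣∣≤length-filter P? f xs S (all∈ ∘ there))
... | no _   = ∣∣≤length-filter P? f xs S (all∈ ∘ there)

length-filter-⊎ : ∀ {A B : Set₁} {P : A → Set} {Q R : B → Set}
  (P? : ∀ x → Dec (P x)) (Q? : ∀ y → Dec (Q y)) (R? : ∀ y → Dec (R y))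
  (f : A → B) → (∀ {x} → P x → Q (f x) ⊎ R (f x)) → ∀ xs →
  length (filter P? xs) ≤ length (filter Q? (map f xs)) + length (filter R? (map f xs))
length-filter-⊎ P? Q? R? f split [] = z≤n
length-filter-⊎ P? Q? R? f split (x ∷ xs)
  with length-filter-⊎ P? Q? R? f split xs | P? x | Q? (f x) | R? (f x)
... | ih | no _   | no _   | no _   = ih
... | ih | no _   | yes _  | no _   = ℕ.m≤n⇒m≤1+n ih
... | ih | no _   | no _   | yes _  = ℕ.≤-trans ih (ℕ.+-monoʳ-≤ _ (ℕ.n≤1+n _))
... | ih | no _   | yes _  | yes _  = ℕ.m≤n⇒m≤1+n (ℕ.≤-trans ih (ℕ.+-monoʳ-≤ _ (ℕ.n≤1+n _)))
... | ih | yes _  | yes _  | no _   = s≤s ih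
... | ih | yes _  | yes _  | yes _  = s≤s (ℕ.≤-trans ih (ℕ.+-monoʳ-≤ _ (ℕ.n≤1+n _)))
... | ih | yes _  | no _   | yes _  = ℕ.≤-trans (s≤s ih) (ℕ.≤-reflexive (sym (ℕ.+-suc _ _)))
... | ih | yes px | no ¬qx | no ¬rx = contradiction (split px) [ ¬qx , ¬rx ]′

argmin : ∀ {n} (f : Fin n → ℕ) (S : Subset n) → Nonempty S →
  ∃ λ i → i ∈ₛ S × (∀ {j} → j ∈ₛ S → f i ≤ f j)
argmin f (outside Vec.∷ S) (suc i , there i∈S) =
  let k , k∈S , least = argmin (f ∘ suc) S (i , i∈S) in
  suc k , there k∈S , λ { (there j∈S) → least j∈S }
argmin f (inside Vec.∷ S) _ with nonempty? S
... | no empty = zero , here , λ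
  { here        → ℕ.≤-refl
  ; (there j∈S) → contradiction (_ , j∈S) empty }
... | yes S≢∅ with argmin (f ∘ suc) S S≢∅
... | k , k∈S , least with ℕ.≤-total (f zero) (f (suc k))
... | inj₁ ≤k = zero , here , λ
  { here        → ℕ.≤-refl
  ; (there j∈S) → ℕ.≤-trans ≤k (least j∈S) }
... | inj₂ ≥k = suc k , there k∈S , λ
  { here        → ≥k
  ; (there j∈S) → least j∈S }

-- Width and pairwise intersecting intervals

WidthAtMost-tail : ∀ {w r rs} → WidthAtMost w (r ∷ rs) → WidthAtMost w rs
WidthAtMost-tail width S anti = width (outside Vec.∷ S) λ
  { (there i∈S) (there j∈S) i≢j → anti i∈S j∈S (i≢j ∘ cong suc) }

clique⇒length-filter≤ : ∀ {w} {P : ℝ → Set} (P? : ∀ r → Dec (P r)) →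
  (∀ {r s} → P r → P s → ¬ r ≺ s) →
  ∀ rs → WidthAtMost w rs → length (filter P? rs) ≤ w
clique⇒length-filter≤ {w} P? clique rs width = subst (_≤ w) (∣select∣ P? rs) $
  width (select P? rs) λ i∈ j∈ _ →
    [ clique (∈-select⁻ P? rs i∈) (∈-select⁻ P? rs j∈)
    , clique (∈-select⁻ P? rs j∈) (∈-select⁻ P? rs i∈) ]′

-- The order of the reals

-- `located` decides only between two distinct rationals, so the witness `q` is first raised to some
-- `p` that is still below `t`.
<ᵣ-cotrans : ∀ {r t} → r <ᵣ t → ∀ s → r <ᵣ s ⊎ s <ᵣ t
<ᵣ-cotrans {t = t} (q , r<q , q<t) s with ℝ.L-open t q<t
... | p , q<p , p<t with ℝ.located s q<p
... | inj₁ q<s = inj₁ (q , r<q , q<s)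
... | inj₂ s<p = inj₂ (p , s<p , p<t)

<ᵣ-irrefl : ∀ {r} → ¬ r <ᵣ r
<ᵣ-irrefl {r} (_ , r<q , q<r) = ℝ.disjoint r (q<r , r<q)

<ᵣ-asym : ∀ {r s} → r <ᵣ s → ¬ s <ᵣ r
<ᵣ-asym {r} {s} (q , r<q , q<s) (p , s<p , p<r) with ℚ.<-cmp p q
... | tri< p<q _ _ = ℝ.disjoint s (ℝ.L-closed s p<q q<s , s<p)
... | tri≈ _ refl _ = ℝ.disjoint s (q<s , s<p)
... | tri> _ _ q<p = ℝ.disjoint r (ℝ.L-closed r q<p p<r , r<q)

-1ᵣ-cancel-<ᵣ : ∀ {r s} → r -1ᵣ <ᵣ s -1ᵣ → r <ᵣ s
-1ᵣ-cancel-<ᵣ (q , r<q , q<s) = q ℚ.+ 1ℚ , r<q , q<s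

q<q+1 : ∀ q → q ℚ.< q ℚ.+ 1ℚ
q<q+1 q = subst (ℚ._< q ℚ.+ 1ℚ) (ℚ.+-identityʳ q) (ℚ.+-monoʳ-< q (ℚ.positive⁻¹ 1ℚ))

≺⇒<ᵣ : ∀ {r s} → r ≺ s → r <ᵣ s
≺⇒<ᵣ {s = s} (q , r<q , q+1<s) = q , r<q , ℝ.L-closed s (q<q+1 q) q+1<s

≺-irrefl : ∀ {r} → ¬ r ≺ r
≺-irrefl {r} = <ᵣ-irrefl {r} ∘ ≺⇒<ᵣ {r} {r}

≺-resp-≈ᵣ : ∀ {r r′ s s′} → r ≈ᵣ r′ → s ≈ᵣ s′ → r ≺ s → r′ ≺ s′
≺-resp-≈ᵣ (_ , U≐) (L≐ , _) (q , r<q , q<s) = q , proj₁ U≐ r<q , proj₁ L≐ q<s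

Comparable-resp-≈ᵣ : ∀ {r r′ s s′} → r ≈ᵣ r′ → s ≈ᵣ s′ → Comparable r s → Comparable r′ s′
Comparable-resp-≈ᵣ {r} {r′} {s} {s′} r≈ s≈ =
  Sum.map (≺-resp-≈ᵣ {r} {r′} {s} {s′} r≈ s≈) (≺-resp-≈ᵣ {s} {s′} {r} {r′} s≈ r≈)

≈ᵣ-sym : ∀ {r s} → r ≈ᵣ s → s ≈ᵣ r
≈ᵣ-sym ((a , b) , (c , d)) = (b , a) , (d , c)

-- The upper bound

module FirstFit (em : ExcludedMiddle 0ℓ) where

  Conflicts : ℝ → ℝ × Label → Set
  Conflicts r (s , _) = ¬ Comparable r s

  blocked : History → ℝ → List Label
  blocked h r = labels (filter (λ e → em {Conflicts r e}) h)

  assign : History → ℝ → Label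
  assign h r = proj₁ (avoid (blocked h r))

  -- Conflicts are invariant under `≈ᵣ`, so the two decisions by `em` cannot differ; `assign-cong`
  -- rests on this.
  blocked-cong : ∀ {h h′ r r′} → h ≈ₕ h′ → r ≈ᵣ r′ → blocked h r ≡ blocked h′ r′
  blocked-cong [] _ = refl
  blocked-cong {e ∷ _} {e′ ∷ _} {r} {r′} ((s≈s′ , l≡l′) ∷ h≈h′) r≈r′
    with em {Conflicts r e} | em {Conflicts r′ e′}
  ... | no _  | no _  = blocked-cong {r = r} {r′} h≈h′ r≈r′
  ... | yes _ | yes _ rewrite l≡l′ = cong (_ ∷_) (blocked-cong {r = r} {r′} h≈h′ r≈r′)
  ... | yes c | no ¬c = contradiction
    (c ∘ Comparable-resp-≈ᵣ {r′} {r} {proj₁ e′} {proj₁ e}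
      (≈ᵣ-sym {r} {r′} r≈r′) (≈ᵣ-sym {proj₁ e} {proj₁ e′} s≈s′)) ¬c
  ... | no ¬c | yes c = contradiction
    (c ∘ Comparable-resp-≈ᵣ {r} {r′} {proj₁ e} {proj₁ e′} r≈r′ s≈s′) ¬c

  same-label⇒Comparable : ∀ h r j → assign h r ≡ proj₂ (lookup h j) →
    Comparable r (proj₁ (lookup h j))
  same-label⇒Comparable h r j same with em {Comparable r (proj₁ (lookup h j))}
  ... | yes c = c
  ... | no ¬c = contradiction
    (subst (_∈ blocked h r) (sym same)
      (∈-map⁺ proj₂ (∈-filter⁺ (λ e → em {Conflicts r e}) (∈-lookup {xs = h} j) ¬c)))
    (proj₁ (proj₂ (avoid (blocked h r))))

  run-correct : ∀ rs → IsChainPartition (run assign rs)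
  run-correct (r ∷ rs) zero    zero    i≢j _    = contradiction refl i≢j
  run-correct (r ∷ rs) zero    (suc j) _   same = same-label⇒Comparable (run assign rs) r j same
  run-correct (r ∷ rs) (suc i) zero    _   same =
    swap (same-label⇒Comparable (run assign rs) r i (sym same))
  run-correct (r ∷ rs) (suc i) (suc j) i≢j same = run-correct rs i j (i≢j ∘ cong suc) same

  firstFit : ∀ w → OnLineAlgorithm w
  firstFit w = record
    { assign      = assign
    ; assign-cong = λ {r = r} {r′} h≈h′ r≈r′ →
        cong (proj₁ ∘ avoid) (blocked-cong {r = r} {r′} h≈h′ r≈r′)
    ; correct     = λ rs _ → run-correct rs
    }

  module _ (r : ℝ) where

    -- `Leftward s` says that [s - 1 , s] contains r - 1, and `Rightward s` that it contains r.
    Leftward Rightward : ℝ → Set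
    Leftward  s = ¬ s ≺ r × ¬ r <ᵣ s
    Rightward s = ¬ r ≺ s × ¬ s <ᵣ r

    -- From s < t - 1, cotransitivity at r - 1 gives s < r - 1 or r < t, and both are excluded.
    Leftward-clique : ∀ {s t} → Leftward s → Leftward t → ¬ s ≺ t
    Leftward-clique {s} {t} (s⊀r , _) (_ , r≮t) s≺t =
      [ s⊀r , r≮t ∘ -1ᵣ-cancel-<ᵣ {r} {t} ]′ (<ᵣ-cotrans {s} {t -1ᵣ} s≺t (r -1ᵣ))

    Rightward-clique : ∀ {s t} → Rightward s → Rightward t → ¬ s ≺ t
    Rightward-clique {s} {t} (_ , s≮r) (r⊀t , _) s≺t =
      [ s≮r , r⊀t ]′ (<ᵣ-cotrans {s} {t -1ᵣ} s≺t r)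

    Leftward? : ∀ s → Dec (Leftward s)
    Leftward? s = em

    Rightward? : ∀ s → Dec (Rightward s)
    Rightward? s = em

    conflict-side : ∀ {s} → ¬ Comparable r s → Leftward s ⊎ Rightward s
    conflict-side {s} conflict with em {r <ᵣ s}
    ... | no r≮s  = inj₁ (conflict ∘ inj₂ , r≮s)
    ... | yes r<s = inj₂ (conflict ∘ inj₁ , <ᵣ-asym {r} {s} r<s)

    -- The new interval `r` takes one of the three places itself, which leaves two for the earlier
    -- ones.
    length-filter-self : ∀ {P : ℝ → Set} (P? : ∀ s → Dec (P s)) rs → P r →
      length (filter P? (r ∷ rs)) ≤ 3 → length (filter P? rs) ≤ 2
    length-filter-self P? rs pr ≤3 =
      s≤s⁻¹ (subst (_≤ 3) (cong length (filter-accept P? pr)) ≤3)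

    length-blocked : ∀ h → WidthAtMost 3 (r ∷ intervals h) → length (blocked h r) ≤ 4
    length-blocked h width = begin
      length (blocked h r)
        ≡⟨ length-map proj₂ (filter (λ e → em {Conflicts r e}) h) ⟩
      length (filter (λ e → em {Conflicts r e}) h)
        ≤⟨ length-filter-⊎ _ Leftward? Rightward? proj₁ (λ {e} → conflict-side {proj₁ e}) h ⟩
      length (filter Leftward? (intervals h)) + length (filter Rightward? (intervals h))
        ≤⟨ ℕ.+-mono-≤
             (length-filter-self Leftward? (intervals h) (≺-irrefl {r} , <ᵣ-irrefl {r})
               (clique⇒length-filter≤ Leftward? (λ {s} {t} → Leftward-clique {s} {t}) _ width))
             (length-filter-self Rightward? (intervals h) (≺-irrefl {r} , <ᵣ-irrefl {r})
               (clique⇒length-filter≤ Rightward? (λ {s} {t} → Rightward-clique {s} {t}) _ width)) ⟩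
      4 ∎
      where open ℕ.≤-Reasoning

  labels<5 : (S : PresenterStrategy) → ∀ n → WidthAtMost 3 (intervals (play S (firstFit 3) n)) →
    All (_< 5) (labels (play S (firstFit 3) n))
  labels<5 S zero    width = []
  labels<5 S (suc n) width =
    let h = play S (firstFit 3) n ; r = S (labels h) in
    s≤s (ℕ.≤-trans (proj₂ (proj₂ (avoid (blocked h r)))) (length-blocked r h width))
    ∷ labels<5 S n (WidthAtMost-tail {r = r} {rs = intervals h} width)

  chainsUsed≤5 : (S : PresenterStrategy) → ∀ n → WidthAtMost 3 (intervals (play S (firstFit 3) n)) →
    chainsUsed (play S (firstFit 3) n) ≤ 5
  chainsUsed≤5 S n width = unique-⊆⇒length-≤ {ys = upTo 5} (deduplicate-! _) λ l∈ →
    ∈-upTo⁺ (All.lookup (labels<5 S n width) (∈-deduplicate⁻ _≟_ (labels (play S (firstFit 3) n)) l∈))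

-- The grid ⅙ℤ

cut : ℚ → ℝ
cut r = record
  { L           = ℚ._< r
  ; U           = r ℚ.<_
  ; L-inhabited = r ℚ.- 1ℚ ,
      subst (r ℚ.- 1ℚ ℚ.<_) (ℚ.+-identityʳ r) (ℚ.+-monoʳ-< r (ℚ.negative⁻¹ (ℚ.- 1ℚ)))
  ; U-inhabited = r ℚ.+ 1ℚ , q<q+1 r
  ; L-closed    = ℚ.<-trans
  ; U-closed    = λ p<q r<p → ℚ.<-trans r<p p<q
  ; L-open      = λ p<r → let q , p<q , q<r = ℚ.<-dense p<r in q , p<q , q<r
  ; U-open      = λ r<q → let p , r<p , p<q = ℚ.<-dense r<q in p , p<q , r<p
  ; disjoint    = λ (q<r , r<q) → ℚ.<-asym q<r r<q
  ; located     = located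
  }
  where
  located : ∀ {p q} → p ℚ.< q → p ℚ.< r ⊎ r ℚ.< q
  located {p} p<q with p ℚ.<? r
  ... | yes p<r = inj₁ p<r
  ... | no  p≮r = inj₂ (ℚ.≤-<-trans (ℚ.≮⇒≥ p≮r) p<q)

-- The rational n/6, by recursion so that a shift by 6 is a ring identity and monotonicity a plain
-- induction.
sixths : ℕ → ℚ
sixths zero    = 0ℚ
sixths (suc n) = (+ 1 ℚ./ 6) ℚ.+ sixths n

sixths-+6 : ∀ n → sixths (6 + n) ≡ sixths n ℚ.+ 1ℚ
sixths-+6 n = solve 1
  (λ s → con ⅙ :+ (con ⅙ :+ (con ⅙ :+ (con ⅙ :+ (con ⅙ :+ (con ⅙ :+ s))))) := s :+ con 1ℚ)
  refl (sixths n)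
  where
  open +-*-Solver
  ⅙ = + 1 ℚ./ 6

sixths-suc : ∀ n → sixths n ℚ.< sixths (suc n)
sixths-suc n = subst (ℚ._< sixths (suc n)) (ℚ.+-identityˡ (sixths n))
  (ℚ.+-monoˡ-< (sixths n) (ℚ.positive⁻¹ (+ 1 ℚ./ 6)))

sixths-mono-≤ : ∀ {m n} → m ≤ n → sixths m ℚ.≤ sixths n
sixths-mono-≤ {n = zero}  z≤n       = ℚ.≤-refl
sixths-mono-≤ {n = suc n} z≤n       = ℚ.≤-trans (sixths-mono-≤ {n = n} z≤n) (ℚ.<⇒≤ (sixths-suc n))
sixths-mono-≤             (s≤s m≤n) = ℚ.+-monoʳ-≤ (+ 1 ℚ./ 6) (sixths-mono-≤ m≤n)

sixths-cancel-< : ∀ {m n} → sixths m ℚ.< sixths n → m < n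
sixths-cancel-< {m} {n} m<n with m <? n
... | yes m<n′ = m<n′
... | no  m≮n  = contradiction (ℚ.<-≤-trans m<n (sixths-mono-≤ (ℕ.≮⇒≥ m≮n))) (ℚ.<-irrefl refl)

point : ℕ → ℝ
point n = cut (sixths n)

point-≺⁺ : ∀ {m n} → 6 + m < n → point m ≺ point n
point-≺⁺ {m} {n} m+6<n =
  -- A strict witness needs room: with `q` between m/6 and (m + 1)/6, q + 1 is below (m + 7)/6, and
  -- 6 + m < n means m + 7 ≤ n.
  let q , m<q , q<1+m = ℚ.<-dense (sixths-suc m) in
  q , m<q , ℚ.<-≤-trans
    (subst (q ℚ.+ 1ℚ ℚ.<_) (sym (sixths-+6 (suc m))) (ℚ.+-monoˡ-< 1ℚ q<1+m))
    (sixths-mono-≤ m+6<n)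

point-≺⁻ : ∀ {m n} → point m ≺ point n → 6 + m < n
point-≺⁻ {m} (q , m<q , q+1<n) = sixths-cancel-<
  (subst (ℚ._< _) (sym (sixths-+6 m)) (ℚ.<-trans (ℚ.+-monoˡ-< 1ℚ m<q) q+1<n))

-- The lower bound

-- An entry (n , c) stands for the interval with right endpoint n / 6 in the
-- c-th chain, chains being numbered in the order of their first use.
Board : Set
Board = List (ℕ × ℕ)

endpoint : ℕ × ℕ → ℝ
endpoint (x , _) = point x

-- The second interval contains the right endpoint of the first, one unit being 6 grid steps.
Window : ℕ × ℕ → ℕ × ℕ → Set
Window (x , _) (y , _) = x ≤ y × y ≤ 6 + x

window? : ∀ e e′ → Dec (Window e e′)
window? (x , _) (y , _) = (x ≤? y) ×-dec (y ≤? 6 + x)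

Narrow : Board → Set
Narrow b = All (λ e → length (filter (window? e) b) ≤ 3) b

entry : ∀ b → Fin (length (map endpoint b)) → ℕ × ℕ
entry b i = lookup b (cast (length-map endpoint b) i)

-- The elements of an antichain lie in the window starting at its leftmost one.
Narrow⇒WidthAtMost : ∀ b → Narrow b → WidthAtMost 3 (map endpoint b)
Narrow⇒WidthAtMost b narrow S anti with nonempty? S
... | no empty  = subst (_≤ 3)
  (sym (trans (cong ∣_∣ (Empty-unique empty)) (∣⊥∣≡0 (length (map endpoint b))))) z≤n
... | yes S≢∅ with argmin (proj₁ ∘ entry b) S S≢∅
... | i , i∈S , least =
  ℕ.≤-trans (∣∣≤length-filter (window? (entry b i)) endpoint b S (λ j∈S → least j∈S , close j∈S))
    (All.lookup narrow (∈-lookup (cast (length-map endpoint b) i)))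
  where
  close : ∀ {j} → j ∈ₛ S → proj₁ (entry b j) ≤ 6 + proj₁ (entry b i)
  close {j} j∈S with proj₁ (entry b j) ≤? 6 + proj₁ (entry b i)
  ... | yes near = near
  ... | no  far with i Fin.≟ j
  ... | yes refl = ℕ.m≤n+m _ 6
  -- An interval beyond the window lies wholly to the right of the leftmost one, so the two are
  -- comparable.
  ... | no  i≢j  = contradiction
    (inj₁ (subst id (sym (cong₂ _≺_ (lookup-map endpoint b i) (lookup-map endpoint b j)))
      (point-≺⁺ (ℕ.≰⇒> far))))
    (anti i∈S j∈S i≢j)

-- In "offer x ts" the presenter offers [x/6 - 1 , x/6] and continues with the
-- c-th tree of ts if the algorithm replies with the c-th chain.  Besides marking
-- the end of the game, "over" fills the places of illegal replies.
data Tree : Set where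
  over  : Tree
  offer : ℕ → List Tree → Tree

-- Played when four chains are in use and each already holds an interval that meets the new one, so
-- that only a fifth chain remains.
final : ℕ → Tree
final x = offer x (replicate 5 over)

-- The winning game tree

opening : Tree
opening = offer 18
  ( offer 9
    ( offer 3
      ( over
      ∷ offer 0
        ( offer 2
          ( over
          ∷ over
          ∷ offer 17
            ( over
            ∷ offer 14
              ( over
              ∷ over
              ∷ offer 7 (over ∷ over ∷ over ∷ final 11 ∷ [])
              ∷ final 8
              ∷ [] )
            ∷ offer 14
              ( over
              ∷ offer 7 (over ∷ over ∷ over ∷ final 11 ∷ [])
              ∷ over
              ∷ final 8
              ∷ [] )
            ∷ offer 10
              ( over
              ∷ offer 11 (over ∷ over ∷ final 16 ∷ over ∷ over ∷ [])
              ∷ offer 11 (over ∷ final 16 ∷ over ∷ over ∷ over ∷ [])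
              ∷ final 7
              ∷ over
              ∷ [] )
            ∷ [] )
          ∷ [] )
        ∷ over
        ∷ offer 17
          ( over
          ∷ offer 12
            ( over
            ∷ over
            ∷ offer 5 (over ∷ over ∷ over ∷ final 11 ∷ [])
            ∷ final 6
            ∷ [] )
          ∷ offer 12
            ( over
            ∷ offer 5 (over ∷ over ∷ over ∷ final 11 ∷ [])
            ∷ over
            ∷ final 6
            ∷ [] )
          ∷ offer 4
            ( over
            ∷ over
            ∷ over
            ∷ offer 10
              ( over
              ∷ offer 11 (over ∷ over ∷ final 16 ∷ over ∷ over ∷ [])
              ∷ offer 11 (over ∷ final 16 ∷ over ∷ over ∷ over ∷ [])
              ∷ over
              ∷ over
              ∷ [] )
            ∷ over
            ∷ [] )
          ∷ [] )
        ∷ [] )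
      ∷ [] )
    ∷ offer 6
      ( offer 20
        ( over
        ∷ offer 10 (over ∷ over ∷ offer 13 (over ∷ over ∷ over ∷ final 16 ∷ []) ∷ [])
        ∷ offer 8
          ( over
          ∷ over
          ∷ offer 13 (over ∷ over ∷ over ∷ final 15 ∷ [])
          ∷ final 14
          ∷ [] )
        ∷ [] )
      ∷ over
      ∷ offer 21
        ( over
        ∷ offer 20
          ( over
          ∷ over
          ∷ offer 12 (over ∷ over ∷ over ∷ final 14 ∷ [])
          ∷ offer 13 (over ∷ over ∷ final 14 ∷ final 12 ∷ over ∷ [])
          ∷ [] )
        ∷ offer 12 (over ∷ over ∷ over ∷ final 15 ∷ [])
        ∷ offer 13 (over ∷ over ∷ final 15 ∷ final 12 ∷ over ∷ [])
        ∷ [] )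
      ∷ [] )
    ∷ [] )
  ∷ [] )

move : Tree → ℕ
-- An arbitrary value, since a strategy has to offer an interval even after the game has ended.
move over        = 0
move (offer x _) = x

nth : List Tree → ℕ → Tree
nth []       _       = over
nth (t ∷ _)  zero    = t
nth (_ ∷ ts) (suc i) = nth ts i

child : Tree → ℕ → Tree
child over         _ = over
child (offer _ ts) i = nth ts i

-- Verification of the tree by computation

Illegal : ℕ → ℕ → Board → Set
Illegal x c = Any λ (y , d) → c ≡ d × x ≤ 6 + y × y ≤ 6 + x

-- Board b has k chains in use.  Covers deals with the replies c , c + 1 , … , k,
-- where k stands for a new chain.  The chain 0 passed to Narrow is a dummy.
mutual
  Wins : Tree → Board → ℕ → Set
  Wins over         b k = 5 ≤ k
  Wins (offer x ts) b k = Narrow ((x , 0) ∷ b) × Covers x ts b k 0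

  Covers : ℕ → List Tree → Board → ℕ → ℕ → Set
  Covers x []       b k c = k < c
  Covers x (t ∷ ts) b k c =
    (Illegal x c b ⊎ Wins t ((x , c) ∷ b) (k ⊔ suc c)) × Covers x ts b k (suc c)

mutual
  wins? : ∀ t b k → Dec (Wins t b k)
  wins? over         b k = 5 ≤? k
  wins? (offer x ts) b k =
    all? (λ e → length (filter (window? e) ((x , 0) ∷ b)) ≤? 3) ((x , 0) ∷ b) ×-dec covers? x ts b k 0

  covers? : ∀ x ts b k c → Dec (Covers x ts b k c)
  covers? x []       b k c = k <? c
  covers? x (t ∷ ts) b k c =
    (any? (λ (y , d) → (c ≟ d) ×-dec (x ≤? 6 + y) ×-dec (y ≤? 6 + x)) b
      ⊎-dec wins? t ((x , c) ∷ b) (k ⊔ suc c))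
    ×-dec covers? x ts b k (suc c)

-- Type checking evaluates the decision procedure on the whole tree, against every legal reply.
opening-wins : Wins opening [] 0
opening-wins = from-yes (wins? opening [] 0)

-- Numbering chains by first use

index : Label → List Label → ℕ
index l []      = 0
index l (m ∷ σ) with l ≟ m
... | yes _ = 0
... | no  _ = suc (index l σ)

-- New labels go to the end, so numbers given earlier never change, and an unseen label has index
-- `length σ`, the number of the next chain.
insert : Label → List Label → List Label
insert l []      = [ l ]
insert l (m ∷ σ) with l ≟ m
... | yes _ = m ∷ σ
... | no  _ = m ∷ insert l σ

index≤length : ∀ l σ → index l σ ≤ length σ
index≤length l []      = z≤n
index≤length l (m ∷ σ) with l ≟ m
... | yes _ = z≤n
... | no  _ = s≤s (index≤length l σ)

-- This is the update `k ⊔ suc c` in `Covers`: the count of chains grows just when the label is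
-- unseen.
length-insert : ∀ l σ → length (insert l σ) ≡ length σ ⊔ suc (index l σ)
length-insert l []      = refl
length-insert l (m ∷ σ) with l ≟ m
... | yes _ = cong suc (sym (ℕ.⊔-identityʳ (length σ)))
... | no  _ = cong suc (length-insert l σ)

-- Membership of `m` excludes the index `length σ`, which all unseen labels share.
index-injective : ∀ {l m σ} → m ∈ σ → index l σ ≡ index m σ → l ≡ m
index-injective {l} {m} {k ∷ σ} m∈ eq with l ≟ k | m ≟ k
index-injective (here m≡k) eq | _ | no m≢k = contradiction m≡k m≢k
... | yes refl | yes refl = refl
index-injective (there m∈) eq | no _ | no _ = index-injective m∈ (ℕ.suc-injective eq)

index-insert : ∀ l {m σ} → m ∈ σ → index m (insert l σ) ≡ index m σ
index-insert l {m} {k ∷ σ} m∈ with l ≟ k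
... | yes _ = refl
... | no  _ with m ≟ k
... | yes _ = refl
... | no m≢k with m∈
... | here m≡k  = contradiction m≡k m≢k
... | there m∈σ = cong suc (index-insert l m∈σ)

index-insert-self : ∀ l σ → index l (insert l σ) ≡ index l σ
index-insert-self l [] with l ≟ l
... | yes _   = refl
... | no  l≢l = contradiction refl l≢l
index-insert-self l (m ∷ σ) with l ≟ m in eq
... | yes _ rewrite eq = refl
... | no  _ rewrite eq = cong suc (index-insert-self l σ)

∈-insert⁺ : ∀ l {m σ} → m ∈ σ → m ∈ insert l σ
∈-insert⁺ l {m} {k ∷ σ} m∈ with l ≟ k
... | yes _ = m∈
... | no  _ with m∈
... | here m≡k  = here m≡k
... | there m∈σ = there (∈-insert⁺ l m∈σ)

∈-insert-self : ∀ l σ → l ∈ insert l σ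
∈-insert-self l [] = here refl
∈-insert-self l (m ∷ σ) with l ≟ m
... | yes l≡m = here l≡m
... | no  _   = there (∈-insert-self l σ)

All-insert⁺ : ∀ {P : Label → Set} {l σ} → P l → All P σ → All P (insert l σ)
All-insert⁺ pl [] = pl ∷ []
All-insert⁺ {l = l} pl (_∷_ {m} pm pσ) with l ≟ m
... | yes _ = pm ∷ pσ
... | no  _ = pm ∷ All-insert⁺ pl pσ

insert-unique : ∀ l {σ} → Unique σ → Unique (insert l σ)
insert-unique l [] = [] ∷ []
insert-unique l (_∷_ {m} m∉σ uσ) with l ≟ m
... | yes _   = m∉σ ∷ uσ
... | no  l≢m = All-insert⁺ (l≢m ∘ sym) m∉σ ∷ insert-unique l uσ

record State : Set where
  constructor state
  field
    tree  : Tree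
    board : Board
    seen  : List Label

open State

step : Label → State → State
step l (state t b σ) = state (child t (index l σ)) ((move t , index l σ) ∷ b) (insert l σ)

-- The presenter sees only labels, so the position is recomputed by replaying them; the latest label
-- is at the head.
follow : List Label → State
follow []       = state opening [] []
follow (l ∷ ls) = step l (follow ls)

strategy : PresenterStrategy
strategy ls = point (move (tree (follow ls)))

-- Membership in `σ` is recorded so that the chain number survives later insertions, by
-- `index-insert`.
Records : List Label → ℝ × Label → ℕ × ℕ → Set₁
Records σ (r , l) (x , c) = r ≡ point x × l ∈ σ × index l σ ≡ c

-- Play against an arbitrary algorithm

module Game (A : OnLineAlgorithm 3) where

  history : ℕ → History
  history = play strategy A

  position : ℕ → State
  position n = follow (labels (history n))

  reply : ℕ → Label
  reply n = OnLineAlgorithm.assign A (history n) (strategy (labels (history n)))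

  -- `correct` speaks of `run` on a fixed list, so the adaptive play is identified with the run on
  -- the intervals that it produced.
  run-intervals : ∀ n → run (OnLineAlgorithm.assign A) (intervals (history n)) ≡ history n
  run-intervals zero = refl
  run-intervals (suc n) rewrite run-intervals n = refl

  isChainPartition : ∀ n → WidthAtMost 3 (intervals (history n)) → IsChainPartition (history n)
  isChainPartition n width =
    subst IsChainPartition (run-intervals n) (OnLineAlgorithm.correct A (intervals (history n)) width)

  recorded : ∀ n → Pointwise (Records (seen (position n))) (history n) (board (position n))
  recorded zero    = []
  recorded (suc n) =
    (refl , ∈-insert-self l σ , index-insert-self l σ)
    ∷ Pointwise.map (λ (r≡ , m∈σ , ≡c) → r≡ , ∈-insert⁺ l m∈σ , trans (index-insert l m∈σ) ≡c) (recorded n)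
    where
    l = reply n
    σ = seen (position n)

  seen-unique : ∀ n → Unique (seen (position n))
  seen-unique zero    = []
  seen-unique (suc n) = insert-unique (reply n) (seen-unique n)

  seen⊆labels : ∀ n → All (_∈ labels (history n)) (seen (position n))
  seen⊆labels zero    = []
  seen⊆labels (suc n) = All-insert⁺ (here refl) (All.map there (seen⊆labels n))

  length-seen≤chainsUsed : ∀ n → length (seen (position n)) ≤ chainsUsed (history n)
  length-seen≤chainsUsed n = unique-⊆⇒length-≤ (seen-unique n)
    (∈-deduplicate⁺ _≟_ ∘ All.lookup (seen⊆labels n))

  intervals-endpoints : ∀ {σ h b} → Pointwise (Records σ) h b → intervals h ≡ map endpoint b
  intervals-endpoints []             = refl
  intervals-endpoints ((r≡ , _) ∷ p) = cong₂ _∷_ r≡ (intervals-endpoints p)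

  -- Equal numbers mean equal labels by `index-injective`, and a shared label forces comparability,
  -- hence endpoints more than 6 grid steps apart.
  legal : ∀ {σ h b} x l → Pointwise (Records σ) h b →
    All (λ (s , m) → l ≡ m → Comparable (point x) s) h → ¬ Illegal x (index l σ) b
  legal {σ} x l ((refl , m∈σ , refl) ∷ _) (comp ∷ _) (here (same , x≤ , y≤))
    with comp (index-injective m∈σ same)
  ... | inj₁ x≺y = ℕ.<⇒≱ (point-≺⁻ x≺y) y≤
  ... | inj₂ y≺x = ℕ.<⇒≱ (point-≺⁻ y≺x) x≤
  legal x l (_ ∷ p) (_ ∷ comp) (there illegal) = legal x l p comp illegal

  head-comparable : ∀ {r l h} → IsChainPartition ((r , l) ∷ h) →
    All (λ (s , m) → l ≡ m → Comparable r s) h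
  head-comparable {r} chain = All.tabulate λ e∈h same →
    subst (Comparable r ∘ proj₁) (sym (lookup-index e∈h))
      (chain zero (suc (Any.index e∈h)) (λ ()) (trans same (cong proj₂ (lookup-index e∈h))))

  Forced : Set
  Forced = ∃ λ n → WidthAtMost 3 (intervals (history n)) × 5 ≤ chainsUsed (history n)

  mutual
    -- Recursion on the tree `t`, which is tied to the position only by an equation so that it
    -- decreases structurally.
    force : ∀ t n → tree (position n) ≡ t → WidthAtMost 3 (intervals (history n)) →
      Wins t (board (position n)) (length (seen (position n))) → Forced
    force over n _ width 5≤ = n , width , ℕ.≤-trans 5≤ (length-seen≤chainsUsed n)
    force (offer x ts) n eq width (narrow , covers) =
      force-reply x ts n 0 (index (reply n) (seen (position n)))
        (cong move eq) (cong (λ t → child t (index (reply n) (seen (position n)))) eq)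
        refl width′ covers
      where
      width′ : WidthAtMost 3 (intervals (history (suc n)))
      -- The width after the round does not depend on the reply, as `endpoint` forgets the chain;
      -- the dummy 0 is therefore harmless.
      width′ = subst (WidthAtMost 3)
        (sym (cong₂ _∷_ (cong (point ∘ move) eq) (intervals-endpoints (recorded n))))
        (Narrow⇒WidthAtMost ((x , 0) ∷ board (position n)) narrow)

    -- A search along `ts`: `c` is the chain number of its first subtree, and `i` subtrees precede
    -- the one for the actual reply.
    force-reply : ∀ x ts n c i → move (tree (position n)) ≡ x →
      tree (position (suc n)) ≡ nth ts i → c + i ≡ index (reply n) (seen (position n)) →
      WidthAtMost 3 (intervals (history (suc n))) →
      Covers x ts (board (position n)) (length (seen (position n))) c → Forced
    -- The list cannot run out: the number of the reply is at most the count of chains in use, which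
    -- is below `c`.
    force-reply x [] n c i _ _ c+i≡ _ k<c = contradiction
      (ℕ.≤-trans (ℕ.m≤m+n c i)
        (subst (_≤ length (seen (position n))) (sym c+i≡) (index≤length (reply n) (seen (position n)))))
      (ℕ.<⇒≱ k<c)
    force-reply x (t ∷ ts) n c (suc i) x≡ t≡ c+i≡ width (_ , covers) =
      force-reply x ts n (suc c) i x≡ t≡ (trans (sym (ℕ.+-suc c i)) c+i≡) width covers
    force-reply x (t ∷ ts) n c zero refl t≡ c≡ width (head , _)
      rewrite trans (sym (ℕ.+-identityʳ c)) c≡ with head
    ... | inj₁ illegal = contradiction illegal
      (legal x (reply n) (recorded n) (head-comparable (isChainPartition (suc n) width)))
    ... | inj₂ wins = force t (suc n) t≡ width
      (subst (Wins t _) (sym (length-insert (reply n) (seen (position n)))) wins)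

corollary3p1 : ExcludedMiddle 0ℓ → olwsR 3 ≔ 5
corollary3p1 em =
    (strategy , λ A → Game.force A opening 0 refl (λ { Vec.[] _ → z≤n }) opening-wins)
  , λ k (S , forces) →
      -- A number that can be forced is forced on `firstFit 3` in particular, which stays within
      -- five chains.
      let n , width , k≤ = forces (firstFit 3) in
      ℕ.≤-trans k≤ (chainsUsed≤5 S n width)
  where open FirstFit em
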